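{- Let $\mathbb{F}_q$ be a finite field with $q$ elements, let $A\subset\mathbb{F}_q$ with $|A|>\sqrt q$, and let $E=A\times A\times A\subset\mathbb{F}_q^3$. Then $$|vol(E)|>\frac q2.$$
   Context: For $x^1,x^2,x^3\in\mathbb{F}_q^3$, $vol(x^1,x^2,x^3)$ is the determinant of the $3\times3$ matrix with rows $x^1,x^2,x^3$, and $vol(E)=\{vol(x^1,x^2,x^3): x^1,x^2,x^3\in E\}\subset\mathbb{F}_q$. -}

module Defs where

open import Algebra.Apartness.Bundles using (HeytingField; HeytingCommutativeRing)
open import Algebra.Bundles using (CommutativeRing)
import Algebra.Properties.CommutativeMonoid.Sum as Sum
import Algebra.Properties.Semiring.Exp as Exp
open import Data.Fin.Base using (Fin; toℕ)
open import Data.Nat.Base using (ℕ; zero; suc)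
open import Data.Product.Base using (∃-syntax; _×_; proj₁)
open import Data.Vec.Functional using (Vector; []; _∷_; tail; removeAt)
open import Data.Vec.Functional.Relation.Unary.All using (All)
open import Function.Bundles using (Inverse)
open import Level using (Level; _⊔_)
open import Relation.Binary.Bundles using (Setoid)
import Relation.Binary.Construct.On as On
import Relation.Binary.PropositionalEquality.Properties as ≡
open import Relation.Unary using (Pred; _∈_)

private
  variable
    a ℓ p : Level

HasCardinality : Setoid a ℓ → ℕ → Set (a ⊔ ℓ)
HasCardinality S n = Inverse S (≡.setoid (Fin n))

-- Elements of a subset are compared by the equality of S alone, so membership
-- proofs do not contribute to the cardinality.
subsetoid : (S : Setoid a ℓ) → Pred (Setoid.Carrier S) p → Setoid (a ⊔ p) ℓ
subsetoid S P = On.setoid S (proj₁ {B = P})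

-- A finite field is a Heyting field whose carrier is in bijection with some
-- Fin q. Finiteness makes _≈_ and _#_ decidable, and tightness then makes
-- x # y equivalent to ¬ (x ≈ y). Since # is irreflexive and x # y holds
-- exactly when x - y is invertible, 0# is not invertible, so 1# ≉ 0#.
module FieldDefs {c ℓ₁ ℓ₂} (F : HeytingField c ℓ₁ ℓ₂) where

  open HeytingField F using (heytingCommutativeRing)

  commutativeRing : CommutativeRing c ℓ₁
  commutativeRing = HeytingCommutativeRing.commutativeRing heytingCommutativeRing

  open CommutativeRing commutativeRing public
    using (Carrier; _≈_; setoid)
  open CommutativeRing commutativeRing
    using (_*_; -_; 1#; semiring; +-commutativeMonoid)
  open Sum +-commutativeMonoid using (sum)
  open Exp semiring using (_^_)

  -- Laplace expansion along the first row; a matrix is the vector of its rows.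
  det : ∀ {n} → Vector (Vector Carrier n) n → Carrier
  det {zero}  M = 1#
  det {suc n} M = sum λ j →
    ((- 1#) ^ toℕ j) * (M Fin.zero j * det (λ i → removeAt (tail M i) j))

  vol : (x¹ x² x³ : Vector Carrier 3) → Carrier
  vol x¹ x² x³ = det (x¹ ∷ x² ∷ x³ ∷ [])

  volSet : Pred (Vector Carrier 3) p → Pred Carrier (c ⊔ ℓ₁ ⊔ p)
  volSet E t = ∃[ x¹ ] ∃[ x² ] ∃[ x³ ]
    x¹ ∈ E × x² ∈ E × x³ ∈ E × t ≈ vol x¹ x² x³

  cube : Pred Carrier p → Pred (Vector Carrier 3) p
  cube A = All A

{-# OPTIONS --safe #-}
module Submission where

open import Defs
open import Algebra.Apartness.Bundles using (HeytingField)
open import Data.Nat.Base using (ℕ; _*_; _^_; _<_)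
open import Data.Product.Base using (∃-syntax; _×_)
open import Relation.Binary.Definitions using (_Respects_)
open import Relation.Unary using (Pred)

open import Algebra.Bundles using (CommutativeRing)
open import Data.Bool.Base using (if_then_else_)
open import Data.Fin.Base as Fin using (Fin; zero; suc; combine; quotient; remainder; _↑ˡ_; _↑ʳ_)
open import Data.Fin.Properties as Fin using (_≟_)
open import Data.List.Base using (List; filter; allFin; length; lookup)
open import Data.List.Membership.Propositional.Properties using (∈-filter⁺; ∈-filter⁻; ∈-allFin; ∈-lookup)
import Data.List.Relation.Unary.All as List
import Data.List.Relation.Unary.AllPairs as AllPairs
open import Data.List.Relation.Unary.Any using (index)
open import Data.List.Relation.Unary.Any.Properties using (lookup-index)
open import Data.List.Relation.Unary.Unique.Propositional using (Unique)
open import Data.List.Relation.Unary.Unique.Propositional.Properties using (filter⁺; allFin⁺)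
open import Data.Nat.Base using (zero; suc; _+_; _≤_; z≤n; s≤s)
open import Data.Nat.Properties hiding (_≟_)
open import Data.Nat.Solver using (module +-*-Solver)
open import Algebra.Properties.Semiring.Sum +-*-semiring
  using (sum; sum-cong-≗; ∑-comm; ∑-distrib-+; *-distribˡ-sum; *-distribʳ-sum)
open import Data.Product.Base using (_,_; proj₁; proj₂)
open import Data.Sum.Base using (inj₁; inj₂)
open import Data.Vec.Functional using (Vector; []; _∷_)
open import Function.Base using (_∘_)
open import Function.Bundles using (Inverse; Injection)
open import Function.Properties.Inverse using (Inverse⇒Injection)
open import Level using (Level)
open import Relation.Binary.Bundles using (Setoid)
open import Relation.Binary.PropositionalEquality
  using (_≡_; refl; sym; trans; cong; cong₂; subst; module ≡-Reasoning)
open import Relation.Nullary using (Dec; yes; no; does; ¬_; ¬?; contradiction)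
open import Relation.Nullary.Decidable using (decidable-stable; map′; via-injection)
open import Relation.Unary using (Decidable)

-- For ξ ≠ 0 let N(ξ) be the number of pairs of points of A × A on which
-- (y₁ , y₂) ↦ y₁ + ξ y₂ agrees. Pairs with distinct first coordinates collide
-- for at most one ξ, so with q = |F| and m = |A|
--   Σ_{ξ ≠ 0} N(ξ) ≤ m² (q − 1 + m² − m).
-- Since m² > q, every such map has a collision x₁ + ξ x₂ = z₁ + ξ z₂ with
-- x₂ ≠ z₂. For nonzero e ∈ A the determinant with rows (x₁, y₁, z₁),
-- (x₂, y₂, z₂), (e, y₃, e) is then − e (x₂ − z₂) (y₁ + ξ y₂) + const, so with
-- n = |vol(A³)| the Cauchy–Schwarz inequality gives m⁴ ≤ n N(ξ) for every
-- ξ ≠ 0. Summing over ξ yields (q − 1) m² ≤ n (q − 1 + m² − m), which forces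
-- 2n > q.

private
  variable
    a ℓ p : Level
    k m n : ℕ

-- Iverson brackets and finite sums of natural numbers.

⟦_⟧ : {P : Set p} → Dec P → ℕ
⟦ P? ⟧ = if does P? then 1 else 0

⟦⟧-no : {P : Set p} (P? : Dec P) → ¬ P → ⟦ P? ⟧ ≡ 0
⟦⟧-no (yes P) ¬P = contradiction P ¬P
⟦⟧-no (no _)  _  = refl

⟦⟧≤1 : {P : Set p} (P? : Dec P) → ⟦ P? ⟧ ≤ 1
⟦⟧≤1 (yes _) = s≤s z≤n
⟦⟧≤1 (no _)  = z≤n

⟦⟧+⟦¬⟧ : {P : Set p} (P? : Dec P) → ⟦ P? ⟧ + ⟦ ¬? P? ⟧ ≡ 1
⟦⟧+⟦¬⟧ (yes _) = refl
⟦⟧+⟦¬⟧ (no _)  = refl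

sum-mono-≤ : {f g : Vector ℕ n} → (∀ i → f i ≤ g i) → sum f ≤ sum g
sum-mono-≤ {zero}  f≤g = z≤n
sum-mono-≤ {suc n} f≤g = +-mono-≤ (f≤g zero) (sum-mono-≤ (f≤g ∘ suc))

sum-const : ∀ n c → sum {n} (λ _ → c) ≡ n * c
sum-const zero    c = refl
sum-const (suc n) c = cong (c +_) (sum-const n c)

sum-zero : {f : Vector ℕ n} → (∀ i → f i ≡ 0) → sum f ≡ 0
sum-zero {n} f≡0 = trans (sum-cong-≗ f≡0) (trans (sum-const n 0) (*-zeroʳ n))

sum-sift : (i : Fin n) (f : Vector ℕ n) → sum (λ j → ⟦ i ≟ j ⟧ * f j) ≡ f i
sum-sift {suc n} zero f = trans (cong₂ _+_ (+-identityʳ (f zero)) (sum-zero {n} λ _ → refl))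
                                (+-identityʳ (f zero))
-- The head term reduces to 0 and `does (suc i ≟ suc j)` to `does (i ≟ j)`, so the induction
-- hypothesis has the right type as it stands.
sum-sift (suc i) f = sum-sift i (f ∘ suc)

sum-indicator : (i : Fin n) → sum (λ j → ⟦ i ≟ j ⟧) ≡ 1
sum-indicator i = trans (sum-cong-≗ λ j → sym (*-identityʳ ⟦ i ≟ j ⟧)) (sum-sift i (λ _ → 1))

sum-co-indicator : (i : Fin (suc n)) → sum (λ j → ⟦ ¬? (i ≟ j) ⟧) ≡ n
sum-co-indicator {n} i = suc-injective (begin
  suc (sum (λ j → ⟦ ¬? (i ≟ j) ⟧))
    ≡⟨ cong (_+ sum (λ j → ⟦ ¬? (i ≟ j) ⟧)) (sum-indicator i) ⟨
  sum (λ j → ⟦ i ≟ j ⟧) + sum (λ j → ⟦ ¬? (i ≟ j) ⟧)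
    ≡⟨ ∑-distrib-+ (λ j → ⟦ i ≟ j ⟧) (λ j → ⟦ ¬? (i ≟ j) ⟧) ⟨
  sum (λ j → ⟦ i ≟ j ⟧ + ⟦ ¬? (i ≟ j) ⟧)
    ≡⟨ sum-cong-≗ (λ j → ⟦⟧+⟦¬⟧ (i ≟ j)) ⟩
  sum {suc n} (λ _ → 1)
    ≡⟨ sum-const (suc n) 1 ⟩
  suc n * 1
    ≡⟨ *-identityʳ (suc n) ⟩
  suc n ∎)
  where open ≡-Reasoning

sum-indicator-≤1 : {P : Pred (Fin n) p} (P? : Decidable P) →
                   (∀ {i j} → P i → P j → i ≡ j) → sum (λ i → ⟦ P? i ⟧) ≤ 1
sum-indicator-≤1 {zero}  P? unique = z≤n
sum-indicator-≤1 {suc n} P? unique with P? zero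
... | yes P0 = ≤-reflexive (cong suc (sum-zero λ i → ⟦⟧-no (P? (suc i)) λ Pi → Fin.0≢1+n (unique P0 Pi)))
... | no  _  = sum-indicator-≤1 (P? ∘ suc) λ Pi Pj → Fin.suc-injective (unique Pi Pj)

sum-↑ : ∀ m (f : Vector ℕ (m + n)) → sum f ≡ sum (λ i → f (i ↑ˡ n)) + sum (λ j → f (m ↑ʳ j))
sum-↑ zero    f = refl
sum-↑ (suc m) f = trans (cong (f zero +_) (sum-↑ m (f ∘ suc))) (sym (+-assoc (f zero) _ _))

sum-combine : ∀ m (f : Vector ℕ (m * n)) → sum f ≡ sum (λ i → sum (λ j → f (combine {m} {n} i j)))
sum-combine         zero    f = refl
sum-combine {n = n} (suc m) f = trans (sum-↑ n f) (cong (sum (λ j → f (j ↑ˡ m * n)) +_) (sum-combine m (λ j → f (n ↑ʳ j))))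

-- Cauchy-Schwarz and collision counts.

2xy≤x²+y² : ∀ x y → x * y + x * y ≤ x * x + y * y
2xy≤x²+y² x y with ≤-total x y
-- With the larger number written as the smaller plus `d`, the deficit is d², which avoids
-- subtraction in ℕ.
... | inj₁ x≤y with d , refl ← m≤n⇒∃[o]m+o≡n x≤y = ≤-trans (m≤m+n _ (d * d)) (≤-reflexive
  (solve 2 (λ x d → (x :* (x :+ d) :+ x :* (x :+ d)) :+ d :* d := x :* x :+ (x :+ d) :* (x :+ d)) refl x d))
  where open +-*-Solver
... | inj₂ y≤x with d , refl ← m≤n⇒∃[o]m+o≡n y≤x = ≤-trans (m≤m+n _ (d * d)) (≤-reflexive
  (solve 2 (λ y d → ((y :+ d) :* y :+ (y :+ d) :* y) :+ d :* d := (y :+ d) :* (y :+ d) :+ y :* y) refl y d))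
  where open +-*-Solver

sum-*-sum : (f : Vector ℕ m) (g : Vector ℕ n) → sum f * sum g ≡ sum (λ i → sum (λ j → f i * g j))
sum-*-sum f g = trans (*-distribʳ-sum (sum g) f) (sum-cong-≗ λ i → *-distribˡ-sum (f i) g)

-- The square expands into a double sum, to which `2xy≤x²+y²` applies termwise; each of the two
-- squares then contributes n Σ f². The factor 2 is introduced for this and cancelled.
cauchySchwarz : (f : Vector ℕ n) → sum f * sum f ≤ n * sum (λ i → f i * f i)
cauchySchwarz {n} f = *-cancelˡ-≤ 2 (begin
  2 * (sum f * sum f)
    ≡⟨ cong (2 *_) (sum-*-sum f f) ⟩
  2 * sum (λ i → sum (λ j → f i * f j))
    ≡⟨ *-distribˡ-sum 2 (λ i → sum (λ j → f i * f j)) ⟩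
  sum (λ i → 2 * sum (λ j → f i * f j))
    ≡⟨ sum-cong-≗ (λ i → *-distribˡ-sum 2 (λ j → f i * f j)) ⟩
  sum (λ i → sum (λ j → 2 * (f i * f j)))
    ≤⟨ sum-mono-≤ (λ i → sum-mono-≤ λ j →
         ≤-trans (≤-reflexive (cong (f i * f j +_) (+-identityʳ _))) (2xy≤x²+y² (f i) (f j))) ⟩
  sum (λ i → sum (λ j → f i * f i + f j * f j))
    ≡⟨ sum-cong-≗ (λ i → trans (∑-distrib-+ (λ _ → f i * f i) (λ j → f j * f j))
                               (cong (_+ S) (sum-const n (f i * f i)))) ⟩
  sum (λ i → n * (f i * f i) + S)
    ≡⟨ ∑-distrib-+ (λ i → n * (f i * f i)) (λ _ → S) ⟩
  sum (λ i → n * (f i * f i)) + sum {n} (λ _ → S)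
    ≡⟨ cong₂ _+_ (*-distribˡ-sum n (λ i → f i * f i)) (sym (sum-const n S)) ⟨
  n * S + n * S
    ≡⟨ cong (n * S +_) (+-identityʳ (n * S)) ⟨
  2 * (n * S) ∎)
  where
  open ≤-Reasoning
  S = sum (λ i → f i * f i)

-- Ordered pairs are counted, the diagonal included, so that this is the sum of the squared fibre
-- sizes.
collisions : (Fin k → Fin n) → ℕ
collisions h = sum λ s → sum λ t → ⟦ h s ≟ h t ⟧

-- Cauchy-Schwarz for the `n` fibre sizes, which add up to `k`.
collisions-lowerBound : (h : Fin k → Fin n) → k * k ≤ n * collisions h
collisions-lowerBound {k} {n} h = begin
  k * k
    ≡⟨ cong₂ _*_ sum-fibre sum-fibre ⟨
  sum fibre * sum fibre
    ≤⟨ cauchySchwarz fibre ⟩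
  n * sum (λ u → fibre u * fibre u)
    ≡⟨ cong (n *_) sum-fibre² ⟩
  n * collisions h ∎
  where
  open ≤-Reasoning
  fibre : Vector ℕ n
  fibre u = sum λ s → ⟦ h s ≟ u ⟧

  sum-fibre : sum fibre ≡ k
  sum-fibre = trans (∑-comm (λ u s → ⟦ h s ≟ u ⟧))
    (trans (sum-cong-≗ (sum-indicator ∘ h)) (trans (sum-const k 1) (*-identityʳ k)))

  sum-fibre² : sum (λ u → fibre u * fibre u) ≡ collisions h
  sum-fibre² =
    trans (sum-cong-≗ λ u → *-distribʳ-sum (fibre u) (λ s → ⟦ h s ≟ u ⟧))
    (trans (∑-comm (λ u s → ⟦ h s ≟ u ⟧ * fibre u))
    -- Each `s` is weighted by the size of the one fibre that contains it.
    (trans (sum-cong-≗ λ s → sum-sift (h s) fibre)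
    (∑-comm (λ s t → ⟦ h t ≟ h s ⟧))))

-- Double counting collisions over a family of maps on a square grid.

module _ {r m n} (h : Fin r → Fin (suc m * suc m) → Fin n)
  (injectiveOnRows : ∀ {x s t} → quotient {suc m} (suc m) s ≡ quotient {suc m} (suc m) t → h x s ≡ h x t → s ≡ t)
  (separates : ∀ {x y s t} → ¬ quotient {suc m} (suc m) s ≡ quotient {suc m} (suc m) t →
               h x s ≡ h x t → h y s ≡ h y t → x ≡ y)
  where

  private
    M = suc m * suc m

    row : Fin M → Fin (suc m)
    row = quotient {suc m} (suc m)

  -- Points in different rows collide under at most one map by `separates`; distinct points of one
  -- row never collide by `injectiveOnRows`; a point collides with itself under all `r` maps.
  pairCollisions-≤ : ∀ s t → sum (λ x → ⟦ h x s ≟ h x t ⟧) ≤ r * ⟦ s ≟ t ⟧ + ⟦ ¬? (row s ≟ row t) ⟧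
  pairCollisions-≤ s t with row s ≟ row t
  ... | no  rs≢rt = ≤-trans (sum-indicator-≤1 (λ x → h x s ≟ h x t) (separates rs≢rt))
                            (m≤n+m 1 (r * ⟦ s ≟ t ⟧))
  ... | yes rs≡rt with s ≟ t
  ...   | yes _  = ≤-trans (sum-mono-≤ λ x → ⟦⟧≤1 (h x s ≟ h x t))
                     (≤-trans (≤-reflexive (sum-const r 1)) (m≤m+n (r * 1) 0))
  ...   | no s≢t = ≤-trans (≤-reflexive (sum-zero λ x → ⟦⟧-no (h x s ≟ h x t) (s≢t ∘ injectiveOnRows rs≡rt))) z≤n

  sum-otherRows : ∀ s → sum (λ t → ⟦ ¬? (row s ≟ row t) ⟧) ≡ suc m * m
  sum-otherRows s = begin
    sum (λ t → ⟦ ¬? (row s ≟ row t) ⟧)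
      ≡⟨ sum-combine {suc m} (suc m) (λ t → ⟦ ¬? (row s ≟ row t) ⟧) ⟩
    sum (λ i → sum (λ j → ⟦ ¬? (row s ≟ row (combine {suc m} {suc m} i j)) ⟧))
      ≡⟨ sum-cong-≗ (λ i → trans
           (sum-cong-≗ λ j → cong (λ i′ → ⟦ ¬? (row s ≟ proj₁ i′) ⟧) (Fin.remQuot-combine {suc m} {suc m} i j))
           (sum-const (suc m) ⟦ ¬? (row s ≟ i) ⟧)) ⟩
    sum (λ i → suc m * ⟦ ¬? (row s ≟ i) ⟧)
      ≡⟨ *-distribˡ-sum (suc m) (λ i → ⟦ ¬? (row s ≟ i) ⟧) ⟨
    suc m * sum (λ i → ⟦ ¬? (row s ≟ i) ⟧)
      ≡⟨ cong (suc m *_) (sum-co-indicator (row s)) ⟩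
    suc m * m ∎
    where open ≡-Reasoning

  -- After exchanging sums the maps are counted for each fixed pair. For fixed `s` the diagonal
  -- gives `r`, and the `m` other rows of `suc m` points give at most 1 per point.
  sum-collisions-≤ : sum (λ x → collisions (h x)) ≤ M * (r + suc m * m)
  sum-collisions-≤ = begin
    sum (λ x → collisions (h x))
      ≡⟨ ∑-comm (λ x s → sum λ t → ⟦ h x s ≟ h x t ⟧) ⟩
    sum (λ s → sum λ x → sum λ t → ⟦ h x s ≟ h x t ⟧)
      ≡⟨ sum-cong-≗ (λ s → ∑-comm (λ x t → ⟦ h x s ≟ h x t ⟧)) ⟩
    sum (λ s → sum λ t → sum λ x → ⟦ h x s ≟ h x t ⟧)
      ≤⟨ sum-mono-≤ (λ s → sum-mono-≤ (pairCollisions-≤ s)) ⟩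
    sum (λ s → sum λ t → r * ⟦ s ≟ t ⟧ + ⟦ ¬? (row s ≟ row t) ⟧)
      ≡⟨ sum-cong-≗ (λ s → trans (∑-distrib-+ (λ t → r * ⟦ s ≟ t ⟧) (λ t → ⟦ ¬? (row s ≟ row t) ⟧))
           (cong₂ _+_ (trans (sym (*-distribˡ-sum r (λ t → ⟦ s ≟ t ⟧)))
                             (trans (cong (r *_) (sum-indicator s)) (*-identityʳ r)))
                      (sum-otherRows s))) ⟩
    sum {M} (λ _ → r + suc m * m)
      ≡⟨ sum-const M (r + suc m * m) ⟩
    M * (r + suc m * m) ∎
    where open ≤-Reasoning

  -- The lower bound M² ≤ n · `collisions (h x)`, summed over the `r` maps, meets the upper bound on
  -- the total; a common factor `M` cancels.
  averaging : r * M ≤ n * (r + suc m * m)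
  averaging = *-cancelʳ-≤ (r * M) (n * (r + suc m * m)) M (begin
    r * M * M
      ≡⟨ *-assoc r M M ⟩
    r * (M * M)
      ≡⟨ sum-const r (M * M) ⟨
    sum {r} (λ _ → M * M)
      ≤⟨ sum-mono-≤ (λ x → collisions-lowerBound (h x)) ⟩
    sum (λ x → n * collisions (h x))
      ≡⟨ *-distribˡ-sum n (λ x → collisions (h x)) ⟨
    n * sum (λ x → collisions (h x))
      ≤⟨ *-monoʳ-≤ n sum-collisions-≤ ⟩
    n * (M * (r + suc m * m))
      ≡⟨ cong (n *_) (*-comm M (r + suc m * m)) ⟩
    n * ((r + suc m * m) * M)
      ≡⟨ *-assoc n (r + suc m * m) M ⟨
    n * (r + suc m * m) * M ∎)
    where open ≤-Reasoning

-- With q = r + 2 and |A| = m + 1, replacing 2n by q in twice the averaging bound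
-- leaves the sides differing by (q − 2) (|A|² − q) + q (|A| − 1) > 0.
averaging⇒large : ∀ r m n → suc (suc r) < suc m * suc m →
                  suc r * (suc m * suc m) ≤ n * (suc r + suc m * m) → suc (suc r) < 2 * n
averaging⇒large r m n q<M bound with suc (suc r) <? 2 * n
... | yes q<2n = q<2n
... | no q≮2n = contradiction upper (<⇒≱ lower)
  where
  open ≤-Reasoning
  -- `e` is |A|² - q - 1, because `q<M` unfolds to q + 1 ≤ |A|².
  e = proj₁ (m≤n⇒∃[o]m+o≡n q<M)

  M≡ : 3 + r + e ≡ suc m * suc m
  M≡ = proj₂ (m≤n⇒∃[o]m+o≡n q<M)

  d+m≡ : suc m * m + m ≡ 2 + r + e
  d+m≡ = suc-injective (sym (trans M≡
    (solve 1 (λ m → (con 1 :+ m) :* (con 1 :+ m) := con 1 :+ ((con 1 :+ m) :* m :+ m)) refl m)))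
    where open +-*-Solver

  0<m : 0 < m
  0<m = n≢0⇒n>0 λ where refl → contradiction d+m≡ λ ()

  upper : 2 * (suc r * (suc m * suc m)) ≤ suc (suc r) * (suc r + suc m * m)
  upper = begin
    2 * (suc r * (suc m * suc m))         ≤⟨ *-monoʳ-≤ 2 bound ⟩
    2 * (n * (suc r + suc m * m))         ≡⟨ *-assoc 2 n _ ⟨
    2 * n * (suc r + suc m * m)           ≤⟨ *-monoˡ-≤ (suc r + suc m * m) (≮⇒≥ q≮2n) ⟩
    suc (suc r) * (suc r + suc m * m)     ∎

  lower : suc (suc r) * (suc r + suc m * m) < 2 * (suc r * (suc m * suc m))
  lower = begin-strict
    suc (suc r) * (suc r + suc m * m)
      -- The slack is the announced difference: `r` is q - 2, `1 + e` is |A|² - q and `m` is |A| -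
      -- 1. It is positive because its second product is at least `m`.
      <⟨ m<m+n _ (≤-trans 0<m (≤-trans (m≤m+n m _) (m≤n+m _ (r * (1 + e))))) ⟩
    suc (suc r) * (suc r + suc m * m) + (r * (1 + e) + suc (suc r) * m)
      ≡⟨ solve 4 (λ r d m e → (con 2 :+ r) :* (con 1 :+ r :+ d) :+ (r :* (con 1 :+ e) :+ (con 2 :+ r) :* m)
                  := (con 2 :+ r) :* (con 1 :+ r :+ (d :+ m)) :+ r :* (con 1 :+ e)) refl r (suc m * m) m e ⟩
    suc (suc r) * (suc r + (suc m * m + m)) + r * (1 + e)
      ≡⟨ cong (λ w → suc (suc r) * (suc r + w) + r * (1 + e)) d+m≡ ⟩
    suc (suc r) * (suc r + (2 + r + e)) + r * (1 + e)
      ≡⟨ solve 2 (λ r e → (con 2 :+ r) :* (con 1 :+ r :+ (con 2 :+ r :+ e)) :+ r :* (con 1 :+ e)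
                  := con 2 :* ((con 1 :+ r) :* (con 3 :+ r :+ e))) refl r e ⟩
    2 * (suc r * (3 + r + e))
      ≡⟨ cong (λ w → 2 * (suc r * w)) M≡ ⟩
    2 * (suc r * (suc m * suc m)) ∎
    where open +-*-Solver

-- Cardinality of decidable subsets of a finite setoid.

lookup-injective : {A : Set a} {xs : List A} → Unique xs → ∀ i j → lookup xs i ≡ lookup xs j → i ≡ j
lookup-injective (x∉xs AllPairs.∷ xs!) zero    zero    eq = refl
lookup-injective (x∉xs AllPairs.∷ xs!) zero    (suc j) eq = contradiction eq (List.lookup x∉xs (∈-lookup j))
lookup-injective (x∉xs AllPairs.∷ xs!) (suc i) zero    eq = contradiction (sym eq) (List.lookup x∉xs (∈-lookup i))
lookup-injective (x∉xs AllPairs.∷ xs!) (suc i) (suc j) eq = cong suc (lookup-injective xs! i j eq)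

module _ {S : Setoid a ℓ} (S↔Fin : HasCardinality S k) where

  open Setoid S using (Carrier; _≈_)
  open Inverse S↔Fin

  to-injective : ∀ {x y} → to x ≡ to y → x ≈ y
  to-injective = Injection.injective (Inverse⇒Injection S↔Fin)

  ≈-dec : ∀ x y → Dec (x ≈ y)
  ≈-dec = via-injection (Inverse⇒Injection S↔Fin) _≟_

  -- The indices in `Fin k` that satisfy `P ∘ from` form a list without repetition, and positions in
  -- that list number the subset. `resp` carries `P` from `s` to its representative `from (to s)`.
  subset-hasCardinality : {P : Pred Carrier p} → P Respects _≈_ → Decidable P →
                          ∃[ n ] HasCardinality (subsetoid S P) n
  subset-hasCardinality {P = P} resp P? = length xs , record
    { to        = λ (s , Ps) → index (position s Ps)
    ; from      = λ i → from (lookup xs i) , proj₂ (∈-filter⁻ P′? {xs = allFin k} (∈-lookup i))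
    ; to-cong   = λ {x} {y} → position-cong x y
    ; from-cong = λ where refl → Setoid.refl S
    ; inverse   = (λ {i} {s} s≈ → trans
                     (position-cong s (from (lookup xs i) , proj₂ (∈-filter⁻ P′? {xs = allFin k} (∈-lookup i))) s≈)
                     (lookup-injective xs! _ i (trans (sym (lookup-index (position _ _))) (strictlyInverseˡ _))))
                , (λ {s} {i} i≡ → Setoid.trans S
                     (from-cong (trans (cong (lookup xs) i≡) (sym (lookup-index (position _ (proj₂ s))))))
                     (strictlyInverseʳ (proj₁ s)))
    }
    where
    P′? : Decidable (P ∘ from)
    P′? i = P? (from i)

    xs : List (Fin k)
    xs = filter P′? (allFin k)

    xs! : Unique xs
    xs! = filter⁺ P′? (allFin⁺ k)

    position = λ s (Ps : P s) →
      ∈-filter⁺ P′? (∈-allFin (to s)) (resp (Setoid.sym S (strictlyInverseʳ s)) Ps)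

    -- A position is read off a membership proof built from `Ps`; as the entries of `xs` are
    -- distinct, only the entry found there matters.
    position-cong : (x y : ∃[ s ] P s) → proj₁ x ≈ proj₁ y →
                    index (position _ (proj₂ x)) ≡ index (position _ (proj₂ y))
    position-cong (x , Px) (y , Py) x≈y = lookup-injective xs! _ _
      (trans (sym (lookup-index (position x Px))) (trans (to-cong x≈y) (lookup-index (position y Py))))

-- Cancellation and linear equations in a finite field.

module FiniteField {c ℓ₁ ℓ₂} (F : HeytingField c ℓ₁ ℓ₂) {q} (F↔Fin : HasCardinality (FieldDefs.setoid F) q) where

  open FieldDefs F
  module K = CommutativeRing commutativeRing
  open K using (0#; 1#) renaming (_+_ to infixl 6 _+ᶠ_; _*_ to infixl 7 _*ᶠ_)
  open HeytingField F using (_#_; #⇒invertible; tight)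
  open import Algebra.Properties.Ring K.ring using (-1*x≈-x; -‿involutive; -0#≈0#; +-cancelˡ; +-cancelʳ)
  open import Algebra.Properties.CommutativeMonoid.Sum K.+-commutativeMonoid
    using () renaming (sum-cong-≋ to sumᶠ-cong)
  open import Algebra.Properties.Semiring.Exp K.semiring using () renaming (_^_ to _^ᶠ_)
  open import Algebra.Solver.Ring.NaturalCoefficients.Default K.commutativeSemiring
  open import Relation.Binary.Reasoning.Setoid K.setoid

  -- Subtraction is written as adding a multiple of `-1#`, so that the semiring solver can treat -1
  -- as a variable.
  -1# : Carrier
  -1# = K.- 1#

  -- Equality is decidable, so one may argue by contradiction: if `y` and `z` differ, `x` cannot be
  -- apart from 0, and tightness makes it 0.
  *-cancelˡ : ∀ {x y z} → ¬ x ≈ 0# → x *ᶠ y ≈ x *ᶠ z → y ≈ z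
  *-cancelˡ {x} {y} {z} x≉0 xy≈xz = decidable-stable (≈-dec F↔Fin y z)
    λ y≉z → x≉0 (proj₁ (tight x 0#) (y≉z ∘ invert))
    where
    invert : x # 0# → y ≈ z
    invert x#0 with x⁻¹ , x⁻¹x≈1 , _ ← #⇒invertible x#0 = begin
      y                             ≈⟨ K.*-identityˡ y ⟨
      1# *ᶠ y                       ≈⟨ K.*-congʳ x⁻¹x≈1′ ⟨
      x⁻¹ *ᶠ x *ᶠ y                 ≈⟨ K.*-assoc x⁻¹ x y ⟩
      x⁻¹ *ᶠ (x *ᶠ y)               ≈⟨ K.*-congˡ xy≈xz ⟩
      x⁻¹ *ᶠ (x *ᶠ z)               ≈⟨ K.*-assoc x⁻¹ x z ⟨
      x⁻¹ *ᶠ x *ᶠ z                 ≈⟨ K.*-congʳ x⁻¹x≈1′ ⟩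
      1# *ᶠ z                       ≈⟨ K.*-identityˡ z ⟩
      z                             ∎
      where
      x⁻¹x≈1′ : x⁻¹ *ᶠ x ≈ 1#
      -- The inverse obtained from apartness is one of x - 0.
      x⁻¹x≈1′ = K.trans (K.*-congˡ (K.sym (K.trans (K.+-congˡ -0#≈0#) (K.+-identityʳ x)))) x⁻¹x≈1

  *-nonzero : ∀ {x y} → ¬ x ≈ 0# → ¬ y ≈ 0# → ¬ x *ᶠ y ≈ 0#
  *-nonzero x≉0 y≉0 xy≈0 = y≉0 (*-cancelˡ x≉0 (K.trans xy≈0 (K.sym (K.zeroʳ _))))

  x+-1*x≈0 : ∀ x → x +ᶠ -1# *ᶠ x ≈ 0#
  x+-1*x≈0 x = K.trans (K.+-congˡ (-1*x≈-x x)) (K.-‿inverseʳ x)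

  -1*-1≈1 : -1# *ᶠ -1# ≈ 1#
  -1*-1≈1 = K.trans (-1*x≈-x -1#) (-‿involutive 1#)

  -- The nonzero `x` witnesses that the ring is nontrivial: x = (-1)²x.
  -1≉0 : ∀ {x} → ¬ x ≈ 0# → ¬ -1# ≈ 0#
  -1≉0 {x} x≉0 -1≈0 = x≉0 (begin
    x                     ≈⟨ K.*-identityˡ x ⟨
    1# *ᶠ x               ≈⟨ K.*-congʳ -1*-1≈1 ⟨
    -1# *ᶠ -1# *ᶠ x       ≈⟨ K.*-congʳ (K.*-congʳ -1≈0) ⟩
    0# *ᶠ -1# *ᶠ x        ≈⟨ K.*-congʳ (K.zeroˡ -1#) ⟩
    0# *ᶠ x               ≈⟨ K.zeroˡ x ⟩
    0#                    ∎)

  difference≉0 : ∀ {x y} → ¬ x ≈ y → ¬ x +ᶠ -1# *ᶠ y ≈ 0#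
  difference≉0 {x} {y} x≉y x-y≈0 = x≉y (+-cancelʳ (-1# *ᶠ y) x y (K.trans x-y≈0 (K.sym (x+-1*x≈0 y))))

  -- A collision as a linear equation for `ξ`, free of division. It yields the uniqueness of `ξ` and
  -- also eliminates x₁ - z₁ from the determinant.
  slope : ∀ {ξ x₁ x₂ z₁ z₂} → x₁ +ᶠ ξ *ᶠ x₂ ≈ z₁ +ᶠ ξ *ᶠ z₂ → (x₂ +ᶠ -1# *ᶠ z₂) *ᶠ ξ +ᶠ x₁ ≈ z₁
  slope {ξ} {x₁} {x₂} {z₁} {z₂} collide = begin
    (x₂ +ᶠ -1# *ᶠ z₂) *ᶠ ξ +ᶠ x₁
      ≈⟨ solve 5 (λ u ξ x₁ x₂ z₂ → (x₂ :+ u :* z₂) :* ξ :+ x₁ := (x₁ :+ ξ :* x₂) :+ u :* (ξ :* z₂))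
               K.refl -1# ξ x₁ x₂ z₂ ⟩
    (x₁ +ᶠ ξ *ᶠ x₂) +ᶠ -1# *ᶠ (ξ *ᶠ z₂)
      ≈⟨ K.+-congʳ collide ⟩
    (z₁ +ᶠ ξ *ᶠ z₂) +ᶠ -1# *ᶠ (ξ *ᶠ z₂)
      ≈⟨ K.+-assoc z₁ _ _ ⟩
    z₁ +ᶠ (ξ *ᶠ z₂ +ᶠ -1# *ᶠ (ξ *ᶠ z₂))
      ≈⟨ K.+-congˡ (x+-1*x≈0 (ξ *ᶠ z₂)) ⟩
    z₁ +ᶠ 0#
      ≈⟨ K.+-identityʳ z₁ ⟩
    z₁ ∎

  slope-unique : ∀ {ξ η x₁ x₂ z₁ z₂} → ¬ x₂ ≈ z₂ →
                 x₁ +ᶠ ξ *ᶠ x₂ ≈ z₁ +ᶠ ξ *ᶠ z₂ → x₁ +ᶠ η *ᶠ x₂ ≈ z₁ +ᶠ η *ᶠ z₂ → ξ ≈ η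
  slope-unique {x₁ = x₁} x₂≉z₂ collideξ collideη = *-cancelˡ (difference≉0 x₂≉z₂)
    (+-cancelʳ x₁ _ _ (K.trans (slope collideξ) (K.sym (slope collideη))))

  -- Determinants with third row (e, y₃, e).

  det-cong : ∀ {n} {M N : Vector (Vector Carrier n) n} → (∀ i j → M i j ≈ N i j) → det M ≈ det N
  det-cong {zero}  M≈N = K.refl
  det-cong {suc n} M≈N = sumᶠ-cong λ j →
    K.*-congˡ {x = -1# ^ᶠ Fin.toℕ j} (K.*-cong (M≈N zero j) (det-cong λ i k → M≈N (suc i) (Fin.punchIn j k)))

  vol-cong : ∀ {x y z x′ y′ z′} → (∀ j → x j ≈ x′ j) → (∀ j → y j ≈ y′ j) → (∀ j → z j ≈ z′ j) →
             vol x y z ≈ vol x′ y′ z′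
  vol-cong {x} {y} {z} {x′} {y′} {z′} x≈ y≈ z≈ = det-cong {M = x ∷ y ∷ z ∷ []} {x′ ∷ y′ ∷ z′ ∷ []} λ where
    zero             → x≈
    (suc zero)       → y≈
    (suc (suc zero)) → z≈

  -- A semiring identity in u = -1: powers of -1 stay unevaluated, since the
  -- solver knows no subtraction.
  vol-expand : ∀ e x₁ y₁ z₁ x₂ y₂ z₂ y₃ →
    vol (x₁ ∷ y₁ ∷ z₁ ∷ []) (x₂ ∷ y₂ ∷ z₂ ∷ []) (e ∷ y₃ ∷ e ∷ []) ≈
    (-1# *ᶠ e *ᶠ (x₂ +ᶠ -1# *ᶠ z₂)) *ᶠ y₁ +ᶠ e *ᶠ (x₁ +ᶠ -1# *ᶠ (-1# *ᶠ -1# *ᶠ z₁)) *ᶠ y₂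
      +ᶠ y₃ *ᶠ (-1# *ᶠ (x₁ *ᶠ z₂) +ᶠ -1# *ᶠ -1# *ᶠ (z₁ *ᶠ x₂))
  vol-expand e x₁ y₁ z₁ x₂ y₂ z₂ y₃ = solve 9
    (λ u e x₁ y₁ z₁ x₂ y₂ z₂ y₃ →
      let det₁ a = con 1 :* (a :* con 1) :+ con 0
          det₂ a b c d = con 1 :* (a :* det₁ d) :+ (u :* con 1 :* (b :* det₁ c) :+ con 0)
      -- The factors `con 1` and summands `con 0` reproduce the zeroth powers, the empty minors and
      -- the empty sums to which `det` unfolds.
      in con 1 :* (x₁ :* det₂ y₂ z₂ y₃ e) :+
         (u :* con 1 :* (y₁ :* det₂ x₂ z₂ e e) :+
         (u :* (u :* con 1) :* (z₁ :* det₂ x₂ y₂ e y₃) :+ con 0))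
      := (u :* e :* (x₂ :+ u :* z₂)) :* y₁ :+ e :* (x₁ :+ u :* (u :* u :* z₁)) :* y₂
         :+ y₃ :* (u :* (x₁ :* z₂) :+ u :* u :* (z₁ :* x₂)))
    K.refl -1# e x₁ y₁ z₁ x₂ y₂ z₂ y₃

  -- Equal outer entries in the third row make the coefficients of `y₁` and `y₂` equal to -e(x₂ -
  -- z₂) and e(x₁ - z₁). The collision gives x₁ - z₁ = -ξ(x₂ - z₂), so the second is `ξ` times the
  -- first.
  vol-pencil : ∀ e {ξ x₁ x₂ z₁ z₂} y₁ y₂ y₃ → x₁ +ᶠ ξ *ᶠ x₂ ≈ z₁ +ᶠ ξ *ᶠ z₂ →
    vol (x₁ ∷ y₁ ∷ z₁ ∷ []) (x₂ ∷ y₂ ∷ z₂ ∷ []) (e ∷ y₃ ∷ e ∷ []) ≈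
    -1# *ᶠ e *ᶠ (x₂ +ᶠ -1# *ᶠ z₂) *ᶠ (y₁ +ᶠ ξ *ᶠ y₂)
      +ᶠ y₃ *ᶠ (-1# *ᶠ (x₁ *ᶠ z₂) +ᶠ -1# *ᶠ -1# *ᶠ (z₁ *ᶠ x₂))
  vol-pencil e {ξ} {x₁} {x₂} {z₁} {z₂} y₁ y₂ y₃ collide =
    K.trans (vol-expand e x₁ y₁ z₁ x₂ y₂ z₂ y₃) (K.+-congʳ (begin
      -1# *ᶠ e *ᶠ D *ᶠ y₁ +ᶠ e *ᶠ (x₁ +ᶠ -1# *ᶠ (-1# *ᶠ -1# *ᶠ z₁)) *ᶠ y₂
        ≈⟨ K.+-congˡ (K.*-congʳ (K.*-congˡ x₁-z₁)) ⟩
      -1# *ᶠ e *ᶠ D *ᶠ y₁ +ᶠ e *ᶠ (-1# *ᶠ (D *ᶠ ξ)) *ᶠ y₂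
        ≈⟨ solve 6 (λ u e D ξ y₁ y₂ → u :* e :* D :* y₁ :+ e :* (u :* (D :* ξ)) :* y₂
                                    := u :* e :* D :* (y₁ :+ ξ :* y₂)) K.refl -1# e D ξ y₁ y₂ ⟩
      -1# *ᶠ e *ᶠ D *ᶠ (y₁ +ᶠ ξ *ᶠ y₂) ∎))
    where
    D = x₂ +ᶠ -1# *ᶠ z₂

    x₁-z₁ : x₁ +ᶠ -1# *ᶠ (-1# *ᶠ -1# *ᶠ z₁) ≈ -1# *ᶠ (D *ᶠ ξ)
    x₁-z₁ = begin
      x₁ +ᶠ -1# *ᶠ (-1# *ᶠ -1# *ᶠ z₁)
        ≈⟨ K.+-congˡ (K.*-congˡ (K.trans (K.*-congʳ -1*-1≈1) (K.*-identityˡ z₁))) ⟩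
      x₁ +ᶠ -1# *ᶠ z₁
        ≈⟨ K.+-congˡ (K.*-congˡ (slope collide)) ⟨
      x₁ +ᶠ -1# *ᶠ (D *ᶠ ξ +ᶠ x₁)
        ≈⟨ solve 3 (λ u x w → x :+ u :* (w :+ x) := u :* w :+ (x :+ u :* x)) K.refl -1# x₁ (D *ᶠ ξ) ⟩
      -1# *ᶠ (D *ᶠ ξ) +ᶠ (x₁ +ᶠ -1# *ᶠ x₁)
        ≈⟨ K.+-congˡ (x+-1*x≈0 x₁) ⟩
      -1# *ᶠ (D *ᶠ ξ) +ᶠ 0#
        ≈⟨ K.+-identityʳ _ ⟩
      -1# *ᶠ (D *ᶠ ξ) ∎

  -- With the outer columns and `y₃` fixed, the constant term of `vol-pencil` cancels, and the
  -- coefficient -e(x₂ - z₂) is nonzero.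
  vol-injective : ∀ {e ξ x₁ x₂ z₁ z₂ y₁ y₂ y₁′ y₂′ y₃} → ¬ e ≈ 0# → ¬ x₂ ≈ z₂ →
    x₁ +ᶠ ξ *ᶠ x₂ ≈ z₁ +ᶠ ξ *ᶠ z₂ →
    vol (x₁ ∷ y₁ ∷ z₁ ∷ []) (x₂ ∷ y₂ ∷ z₂ ∷ []) (e ∷ y₃ ∷ e ∷ []) ≈
    vol (x₁ ∷ y₁′ ∷ z₁ ∷ []) (x₂ ∷ y₂′ ∷ z₂ ∷ []) (e ∷ y₃ ∷ e ∷ []) →
    y₁ +ᶠ ξ *ᶠ y₂ ≈ y₁′ +ᶠ ξ *ᶠ y₂′
  vol-injective {e} {y₁ = y₁} {y₂} {y₁′} {y₂′} {y₃} e≉0 x₂≉z₂ collide vol≈vol′ =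
    *-cancelˡ (*-nonzero (*-nonzero (-1≉0 e≉0) e≉0) (difference≉0 x₂≉z₂))
      (+-cancelʳ _ _ _ (K.trans (K.sym (vol-pencil e y₁ y₂ y₃ collide))
        (K.trans vol≈vol′ (vol-pencil e y₁′ y₂′ y₃ collide))))

  -- Enumeration of A³ and the linear forms on A × A.

  module _ {p} (A : Pred Carrier p) {m} (A↔Fin : HasCardinality (subsetoid setoid A) m) where

    private
      module F↔Fin = Inverse F↔Fin
      module A↔Fin = Inverse A↔Fin

    element : Fin m → Carrier
    element i = proj₁ (A↔Fin.from i)

    element∈A : ∀ i → A (element i)
    element∈A i = proj₂ (A↔Fin.from i)

    element-injective : ∀ {i j} → element i ≈ element j → i ≡ j
    element-injective {i} {j} ei≈ej =
      trans (sym (A↔Fin.strictlyInverseˡ i)) (trans (A↔Fin.to-cong ei≈ej) (A↔Fin.strictlyInverseˡ j))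

    point : Fin (m ^ 3) → Vector Carrier 3
    point s j = element (Fin.finToFun {m} {3} s j)

    point-surjective : ∀ {x} → cube A x → ∃[ s ] (∀ j → x j ≈ point s j)
    point-surjective {x} x∈A³ = Fin.funToFin f , λ j →
      K.trans (K.sym (A↔Fin.strictlyInverseʳ (x j , x∈A³ j)))
              (K.reflexive (cong element (sym (Fin.finToFun-funToFin f j))))
      where
      f : Fin 3 → Fin m
      f j = A↔Fin.to (x j , x∈A³ j)

    -- `point` reaches all of A³ up to `≈`, so membership is a finite search over triples of
    -- indices.
    volSet? : Decidable (volSet (cube A))
    volSet? t = map′
      (λ (s₁ , s₂ , s₃ , t≈) →
        point s₁ , point s₂ , point s₃ , (λ _ → element∈A _) , (λ _ → element∈A _) , (λ _ → element∈A _) , t≈)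
      (λ (x , y , z , x∈ , y∈ , z∈ , t≈) →
        let s₁ , x≈ = point-surjective x∈
            s₂ , y≈ = point-surjective y∈
            s₃ , z≈ = point-surjective z∈
        in s₁ , s₂ , s₃ , K.trans t≈ (vol-cong x≈ y≈ z≈))
      (Fin.any? λ s₁ → Fin.any? λ s₂ → Fin.any? λ s₃ → ≈-dec F↔Fin t (vol (point s₁) (point s₂) (point s₃)))

    volSet-cardinality : ∃[ n ] HasCardinality (subsetoid setoid (volSet (cube A))) n
    volSet-cardinality = subset-hasCardinality F↔Fin
      (λ t≈t′ (x , y , z , x∈ , y∈ , z∈ , t≈) → x , y , z , x∈ , y∈ , z∈ , K.trans (K.sym t≈t′) t≈)
      volSet?

    -- The linear form y₁ + ξy₂, with `s` encoding (y₁, y₂) as quotient and remainder; its fibres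
    -- lie on parallel lines.
    line : Carrier → Fin (m * m) → Carrier
    line ξ s = element (quotient {m} m s) +ᶠ ξ *ᶠ element (remainder {m} m s)

    remQuot-injective : ∀ {s t} → quotient {m} m s ≡ quotient {m} m t →
                        remainder {m} m s ≡ remainder {m} m t → s ≡ t
    remQuot-injective {s} {t} q≡ r≡ =
      trans (sym (Fin.combine-remQuot {m} m s)) (trans (cong₂ combine q≡ r≡) (Fin.combine-remQuot {m} m t))

    line-injective-on-columns : ∀ {ξ s t} → line ξ s ≈ line ξ t →
      element (remainder {m} m s) ≈ element (remainder {m} m t) → s ≡ t
    line-injective-on-columns {ξ} {s} {t} collide r≈ = remQuot-injective
      (element-injective (+-cancelʳ _ _ _ (K.trans collide (K.+-congˡ (K.*-congˡ (K.sym r≈))))))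
      (element-injective r≈)

    -- Cancelling the common first coordinate leaves `ξ` times the second, so `ξ` must be nonzero
    -- here.
    line-injective-on-rows : ∀ {ξ s t} → ¬ ξ ≈ 0# → quotient {m} m s ≡ quotient {m} m t →
      line ξ s ≈ line ξ t → s ≡ t
    line-injective-on-rows {ξ} {s} {t} ξ≉0 q≡ collide = line-injective-on-columns {s = s} {t} collide
      (*-cancelˡ ξ≉0 (+-cancelˡ _ _ _ (K.trans collide (K.+-congʳ (K.reflexive (cong element (sym q≡)))))))

    -- Colliding points with the same second coordinate coincide, so points in different rows differ
    -- there and `slope-unique` applies.
    line-separates : ∀ {ξ η s t} → ¬ quotient {m} m s ≡ quotient {m} m t →
      line ξ s ≈ line ξ t → line η s ≈ line η t → ξ ≈ η
    line-separates {s = s} {t} q≢ collideξ collideη = slope-unique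
      (λ r≈ → q≢ (cong (quotient {m} m) (line-injective-on-columns {s = s} {t} collideξ r≈)))
      collideξ collideη

    -- Pigeonhole gives two distinct points with one value; equal second coordinates would make them
    -- coincide.
    line-collision : q < m * m → ∀ ξ → ∃[ s ] ∃[ t ]
      (¬ element (remainder {m} m s) ≈ element (remainder {m} m t)) × line ξ s ≈ line ξ t
    line-collision q<m² ξ with s , t , s<t , to≡ ← Fin.pigeonhole q<m² (F↔Fin.to ∘ line ξ) =
      s , t , (λ r≈ → Fin.<⇒≢ s<t (line-injective-on-columns {s = s} {t} collide r≈)) , collide
      where
      collide : line ξ s ≈ line ξ t
      collide = to-injective F↔Fin to≡

    -- One collision of the form `line ξ` fixes the outer columns of a matrix, the middle column
    -- runs through A × A, and `h` numbers the resulting determinants within vol(A³).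
    lineToVol : q < m * m → ∀ {n} → HasCardinality (subsetoid setoid (volSet (cube A))) n →
      ∀ {i} → ¬ element i ≈ 0# → ∀ ξ →
      ∃[ h ] (∀ {s t : Fin (m * m)} → h s ≡ h t → line ξ s ≈ line ξ t)
    lineToVol q<m² {n} V↔Fin {i} e≉0 ξ with s₀ , t₀ , r≉ , collide ← line-collision q<m² ξ =
      h , λ {s} {t} h≡ → vol-injective e≉0 r≉ collide (to-injective V↔Fin {vols s} {vols t} h≡)
      where
      triple : ∀ i j k → cube A (element i ∷ element j ∷ element k ∷ [])
      triple i j k zero             = element∈A i
      triple i j k (suc zero)       = element∈A j
      triple i j k (suc (suc zero)) = element∈A k

      vols : Fin (m * m) → ∃[ v ] volSet (cube A) v
      vols s = _ , _ , _ , _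
        , triple (quotient {m} m s₀) (quotient {m} m s) (quotient {m} m t₀)
        , triple (remainder {m} m s₀) (remainder {m} m s) (remainder {m} m t₀)
        -- The free entry y₃ is also set to `e`.
        , triple i i i
        , K.refl

      h : Fin (m * m) → Fin n
      h s = Inverse.to V↔Fin (vols s)

-- Nonzero parameters ξ and the final bound.

module _ {c ℓ₁ ℓ₂} (F : HeytingField c ℓ₁ ℓ₂) where

  open FieldDefs F
  open HeytingField F using (0#)

  module Nonzero {r} (F↔Fin : HasCardinality setoid (suc r)) where

    open Inverse F↔Fin

    nonzero : Fin r → Carrier
    nonzero x = from (Fin.punchIn (to 0#) x)

    nonzero≉0 : ∀ x → ¬ nonzero x ≈ 0#
    nonzero≉0 x x≈0 = Fin.punchInᵢ≢i (to 0#) x (trans (sym (strictlyInverseˡ _)) (to-cong x≈0))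

    nonzero-injective : ∀ {x y} → nonzero x ≈ nonzero y → x ≡ y
    nonzero-injective {x} {y} x≈y = Fin.punchIn-injective (to 0#) x y
      (trans (sym (strictlyInverseˡ _)) (trans (to-cong x≈y) (strictlyInverseˡ _)))

  module _ {p} {A : Pred Carrier p} where

    -- Two distinct elements of `A` cannot both vanish.
    nonzeroElement : ∀ {q m} (F↔Fin : HasCardinality setoid q) (A↔Fin : HasCardinality (subsetoid setoid A) (2 + m)) →
                     ∃[ i ] ¬ FiniteField.element F F↔Fin A A↔Fin i ≈ 0#
    nonzeroElement F↔Fin A↔Fin with ≈-dec F↔Fin (FiniteField.element F F↔Fin A A↔Fin zero) 0#
    ... | no  a₀≉0 = zero , a₀≉0
    ... | yes a₀≈0 = suc zero , λ a₁≈0 → Fin.0≢1+n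
      (FiniteField.element-injective F F↔Fin A A↔Fin (Setoid.trans setoid a₀≈0 (Setoid.sym setoid a₁≈0)))

    volSet-large : ∀ q m n → HasCardinality setoid q → HasCardinality (subsetoid setoid A) m →
                   HasCardinality (subsetoid setoid (volSet (cube A))) n → q < m * m → q < 2 * n
    volSet-large zero          m             n F↔Fin A↔Fin V↔Fin q<m² = contradiction (Inverse.to F↔Fin 0#) λ ()
    volSet-large (suc q)       (suc zero)    n F↔Fin A↔Fin V↔Fin (s≤s ())
    volSet-large (suc zero)    (suc (suc m)) n F↔Fin A↔Fin V↔Fin q<m² with i , e≉0 ← nonzeroElement F↔Fin A↔Fin =
      contradiction (to-injective F↔Fin (Fin1-irrelevant _ _)) e≉0
      where
      Fin1-irrelevant : (x y : Fin 1) → x ≡ y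
      Fin1-irrelevant zero zero = refl
    volSet-large (suc (suc r)) (suc (suc m)) n F↔Fin A↔Fin V↔Fin q<m² with i , e≉0 ← nonzeroElement F↔Fin A↔Fin =
      -- There are q - 1 = `suc r` maps, one for each nonzero `ξ`, and |A| - 1 is `suc m`. Equal
      -- labels imply equal values of `line`, so both hypotheses of `averaging` follow from those
      -- for lines.
      averaging⇒large r (suc m) n q<m² (averaging (λ x → proj₁ (map x))
        (λ {x} {s} {t} rows≡ h≡ →
          line-injective-on-rows A A↔Fin {s = s} {t} (nonzero≉0 x) rows≡ (proj₂ (map x) {s} {t} h≡))
        (λ {x} {y} {s} {t} rows≢ hx≡ hy≡ → nonzero-injective
          (line-separates A A↔Fin {s = s} {t} rows≢ (proj₂ (map x) {s} {t} hx≡) (proj₂ (map y) {s} {t} hy≡))))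
      where
      open FiniteField F F↔Fin
      open Nonzero F↔Fin
      map = λ x → lineToVol A A↔Fin q<m² V↔Fin e≉0 (nonzero x)

theorem2p7 : ∀ {c ℓ₁ ℓ₂ p} (F : HeytingField c ℓ₁ ℓ₂) → let open FieldDefs F in
    (q : ℕ) → HasCardinality setoid q →
    (A : Pred Carrier p) → A Respects _≈_ →
    (m : ℕ) → HasCardinality (subsetoid setoid A) m →
    q < m ^ 2 →
    ∃[ n ] HasCardinality (subsetoid setoid (volSet (cube A))) n × q < 2 * n
theorem2p7 F q F↔Fin A _ m A↔Fin q<m^2 =
  let n , V↔Fin = FiniteField.volSet-cardinality F F↔Fin A A↔Fin
  -- `m ^ 2` unfolds to `m * (m * 1)`.
  in n , V↔Fin , volSet-large F q m n F↔Fin A↔Fin V↔Fin (subst (λ w → q < m * w) (*-identityʳ m) q<m^2)
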